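{- Let $n\ge 6$ and $r_n=0^{n-4}1011$. For every $\alpha\in\mathbf{A}(n)\setminus\{r_n\}$ define $$\mathrm{par}(\alpha)=\begin{cases}\mathrm{FirstOne}(\alpha) & \text{if }\mathrm{FirstOne}(\alpha)\in\mathbf{A}(n),\\ \mathrm{LastOne}(\alpha) & \text{if }\mathrm{FirstOne}(\alpha)\notin\mathbf{A}(n)\text{ and }\mathrm{LastOne}(\alpha)\in\mathbf{A}(n),\\ \mathrm{LastZero}(\alpha) & \text{otherwise.}\end{cases}$$ Then $\mathrm{par}(\alpha)\in\mathbf{A}(n)$ for every $\alpha\in\mathbf{A}(n)\setminus\{r_n\}$, and the graph on vertex set $\mathbf{A}(n)$ with edges $\{\alpha,\mathrm{par}(\alpha)\}$ is a tree rooted at $r_n$ (every $\alpha$ reaches $r_n$ by iterating $\mathrm{par}$), and this tree has height less than $2(n-4)$.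
   Context: Binary strings are compared lexicographically with $0<1$ (a proper prefix is smaller). For $\alpha=a_1\cdots a_n$, $\alpha^R=a_n\cdots a_1$. $[\alpha]$ is the set of rotations of $\alpha$; $\alpha$ is a necklace if it is lexicographically smallest in $[\alpha]$, and a bracelet if lexicographically smallest in $[\alpha]\cup[\alpha^R]$. A necklace $\alpha$ is symmetric if $\alpha^R\in[\alpha]$, otherwise asymmetric. $\mathbf{A}(n)$ is the set of length-$n$ asymmetric bracelets (bracelets that are not symmetric); every element begins with $0$ and ends with $1$. For $\alpha=a_1\cdots a_n\in\mathbf{A}(n)$: $\mathrm{FirstOne}(\alpha)$ is $\alpha$ with its first $1$ flipped to $0$; $\mathrm{LastOne}(\alpha)$ is the necklace (lexicographically smallest rotation) of $a_1\cdots a_{n-1}0$; $\mathrm{LastZero}(\alpha)$ is $\alpha$ with its last $0$ flipped to $1$. -}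

module Defs where

open import Data.Bool using (Bool; true; false; _∧_; _∨_; not; if_then_else_; T)
open import Data.Nat using (ℕ; zero; suc; _≡ᵇ_; _∸_)
open import Data.Bool.ListAction using (all; any)
open import Data.List using (List; []; _∷_; _++_; drop; take; length; map; reverse; upTo; foldl; replicate)

-- Binary strings: lists of booleans, false = 0, true = 1.
BStr : Set
BStr = List Bool

_≤ᵇ_ : BStr → BStr → Bool
[] ≤ᵇ _ = true
(_ ∷ _) ≤ᵇ [] = false
(false ∷ xs) ≤ᵇ (false ∷ ys) = xs ≤ᵇ ys
(true ∷ xs) ≤ᵇ (true ∷ ys) = xs ≤ᵇ ys
(false ∷ _) ≤ᵇ (true ∷ _) = true
(true ∷ _) ≤ᵇ (false ∷ _) = false

_==ᵇ_ : BStr → BStr → Bool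
[] ==ᵇ [] = true
(false ∷ xs) ==ᵇ (false ∷ ys) = xs ==ᵇ ys
(true ∷ xs) ==ᵇ (true ∷ ys) = xs ==ᵇ ys
_ ==ᵇ _ = false

rotate : ℕ → BStr → BStr
rotate k α = drop k α ++ take k α

rotations : BStr → List BStr
rotations α = map (λ k → rotate k α) (upTo (length α))

isNecklace : BStr → Bool
isNecklace α = all (α ≤ᵇ_) (rotations α)

isBracelet : BStr → Bool
isBracelet α = all (α ≤ᵇ_) (rotations α ++ rotations (reverse α))

isSymmetric : BStr → Bool
isSymmetric α = any (λ β → β ==ᵇ reverse α) (rotations α)

isAsymBracelet : BStr → Bool
isAsymBracelet α = isBracelet α ∧ not (isSymmetric α)

inA : ℕ → BStr → Bool
inA n α = (length α ≡ᵇ n) ∧ isAsymBracelet α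

A : ℕ → BStr → Set
A n α = T (inA n α)

neck : BStr → BStr
neck β = foldl (λ best γ → if γ ≤ᵇ best then γ else best) β (rotations β)

firstOne : BStr → BStr
firstOne [] = []
firstOne (false ∷ xs) = false ∷ firstOne xs
firstOne (true ∷ xs) = false ∷ xs

lastTo0 : BStr → BStr
lastTo0 [] = []
lastTo0 (_ ∷ []) = false ∷ []
lastTo0 (x ∷ y ∷ xs) = x ∷ lastTo0 (y ∷ xs)

lastOne : BStr → BStr
lastOne α = neck (lastTo0 α)

lastZero : BStr → BStr
lastZero α = reverse (flip (reverse α))
  where
  flip : BStr → BStr
  flip [] = []
  flip (true ∷ xs) = true ∷ flip xs
  flip (false ∷ xs) = true ∷ xs

r : ℕ → BStr
r n = replicate (n ∸ 4) false ++ (true ∷ false ∷ true ∷ true ∷ [])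

par : ℕ → BStr → BStr
par n α =
  if inA n (firstOne α) then firstOne α
  else if inA n (lastOne α) then lastOne α
  else lastZero α

parStep : ℕ → BStr → BStr
parStep n α = if α ==ᵇ r n then α else par n α

iter : {X : Set} → (X → X) → ℕ → X → X
iter f zero x = x
iter f (suc k) x = iter f k (f x)

{-# OPTIONS --safe #-}
module Submission where

-- Write α = 0^s δ with δ starting with 1. If the initial run 0^p of 0^p δ is longer than every run of
-- zeros in δ, then 0^p δ is an asymmetric bracelet as soon as δ < δ^R; this settles membership of
-- FirstOne(α) and LastOne(α), whose initial runs are strictly longer than 0^s. When both fail, α = 0^s 1 0 ⋯,
-- because 1β < β^R 1 forces β < β^R. Writing α = μ 0 1^j, the string μ 1 1^j is a Lyndon word, and it is an
-- asymmetric bracelet unless μ = u 1^i with u a palindrome and i < j, which leaves only α = r_n.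
-- LastZero keeps s and makes LastOne applicable, so s grows at least once every two steps, from
-- s ≥ 1 up to n − 4, where r_n is the only member.

open import Defs
open import Data.Bool using (Bool; true; false; T; not; if_then_else_)
open import Data.Bool.Properties using (T-∧; T-≡; T-not-≡)
open import Data.Empty using (⊥; ⊥-elim)
open import Data.List using ([]; _∷_; _++_; _∷ʳ_; length; reverse; replicate; take; drop; foldl; initLast; _∷ʳ′_)
open import Data.List.Membership.Propositional using (_∈_; find; lose)
open import Data.List.Membership.Propositional.Properties using (∈-map⁺; ∈-map⁻; ∈-upTo⁺; ∈-++⁺ˡ; ∈-++⁺ʳ; ∈-++⁻)
open import Data.List.Properties using (++-assoc; ++-identityʳ; length-++; length-++-comm; length-replicate; length-reverse; reverse-++; reverse-involutive; unfold-reverse; take++drop≡id; ∷-injective; ∷-injectiveʳ; ∷ʳ-injectiveʳ; ∷ʳ-++)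
open import Data.List.Relation.Unary.All using (lookup; tabulate)
open import Data.List.Relation.Unary.All.Properties using (all⁺; all⁻)
open import Data.List.Relation.Unary.Any using (here; there)
open import Data.List.Relation.Unary.Any.Properties using (any⁺; any⁻)
open import Data.Nat using (ℕ; zero; suc; _≡ᵇ_; _+_; _≤_; _<_; _*_; _∸_; z≤n; s≤s)
open import Data.Nat.Properties using (≡ᵇ⇒≡; ≡⇒≡ᵇ; suc-injective; +-comm; +-suc; +-identityʳ; m≤n+m; m<m+n; m≤n⇒m≤1+n; +-cancelˡ-≡; *-suc)
open import Data.Product using (_×_; _,_; proj₁; proj₂; ∃-syntax)
open import Data.Sum using (_⊎_; inj₁; inj₂)
open import Function using (_∘_; case_of_)
open import Function.Bundles using (Equivalence)
open import Relation.Binary.PropositionalEquality using (_≡_; _≢_; refl; sym; trans; cong; cong₂; subst; subst₂; module ≡-Reasoning)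
open import Relation.Nullary using (¬_)

-- Runs of equal bits and factorizations of strings

zeros ones : ℕ → BStr
zeros k = replicate k false
ones k = replicate k true

replicate-∷ʳ : ∀ k (b : Bool) xs → replicate k b ++ b ∷ xs ≡ b ∷ replicate k b ++ xs
replicate-∷ʳ zero b xs = refl
replicate-∷ʳ (suc k) b xs = cong (b ∷_) (replicate-∷ʳ k b xs)

replicate-+ : ∀ m k (b : Bool) → replicate (m + k) b ≡ replicate m b ++ replicate k b
replicate-+ zero k b = refl
replicate-+ (suc m) k b = cong (b ∷_) (replicate-+ m k b)

reverse-replicate : ∀ k (b : Bool) → reverse (replicate k b) ≡ replicate k b
reverse-replicate zero b = refl
reverse-replicate (suc k) b = begin
  reverse (b ∷ replicate k b)    ≡⟨ unfold-reverse b (replicate k b) ⟩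
  reverse (replicate k b) ∷ʳ b   ≡⟨ cong (_∷ʳ b) (reverse-replicate k b) ⟩
  replicate k b ∷ʳ b             ≡⟨ replicate-∷ʳ k b [] ⟩
  b ∷ replicate k b ++ []        ≡⟨ ++-identityʳ _ ⟩
  b ∷ replicate k b              ∎
  where open ≡-Reasoning

replicate-++⁻ : ∀ k {b : Bool} u w → replicate k b ≡ u ++ w → ∃[ i ] ∃[ j ] (u ≡ replicate i b × w ≡ replicate j b)
replicate-++⁻ k [] w e = 0 , k , refl , sym e
replicate-++⁻ (suc k) (x ∷ u) w e with refl , e′ ← ∷-injective e with i , j , p , q ← replicate-++⁻ k u w e′ =
  suc i , j , cong (x ∷_) p , q

reverse-swap : ∀ {x y : BStr} → reverse x ≡ y → x ≡ reverse y
reverse-swap {x} refl = sym (reverse-involutive x)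

-- The second case keeps `b ∷ w` nonempty, so a cut exactly at the boundary falls under the first
-- case alone.
++-split : ∀ (u v p q : BStr) → u ++ v ≡ p ++ q →
  (∃[ w ] (p ≡ u ++ w × v ≡ w ++ q)) ⊎ (∃[ b ] ∃[ w ] (u ≡ p ++ b ∷ w × q ≡ b ∷ w ++ v))
++-split [] v p q e = inj₁ (p , refl , e)
++-split (x ∷ u) v [] q e = inj₂ (x , u , refl , sym e)
++-split (x ∷ u) v (y ∷ p) q e with refl , e′ ← ∷-injective e with ++-split u v p q e′
... | inj₁ (w , h , k) = inj₁ (w , cong (x ∷_) h , k)
... | inj₂ (b , w , h , k) = inj₂ (b , w , cong (x ∷_) h , k)

zeros-or-one : ∀ (α : BStr) → (∃[ k ] α ≡ zeros k) ⊎ (∃[ s ] ∃[ τ ] α ≡ zeros s ++ true ∷ τ)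
zeros-or-one [] = inj₁ (0 , refl)
zeros-or-one (true ∷ α) = inj₂ (0 , α , refl)
zeros-or-one (false ∷ α) with zeros-or-one α
... | inj₁ (k , e) = inj₁ (suc k , cong (false ∷_) e)
... | inj₂ (s , τ , e) = inj₂ (suc s , τ , cong (false ∷_) e)

ones-or-last-zero : ∀ (α : BStr) → (∃[ k ] α ≡ ones k) ⊎ (∃[ μ ] ∃[ j ] α ≡ μ ++ false ∷ ones j)
ones-or-last-zero [] = inj₁ (0 , refl)
ones-or-last-zero (b ∷ α) with ones-or-last-zero α
ones-or-last-zero (b ∷ α) | inj₂ (μ , j , e) = inj₂ (b ∷ μ , j , cong (b ∷_) e)
ones-or-last-zero (true ∷ α) | inj₁ (k , e) = inj₁ (suc k , cong (true ∷_) e)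
ones-or-last-zero (false ∷ α) | inj₁ (k , e) = inj₂ ([] , k , cong (false ∷_) e)

-- Lexicographic order

infix 4 _≺_

-- Unlike the lexicographic order, a proper prefix is not smaller: the strings must differ at a
-- common position, so that ≺ is stable under appending arbitrary suffixes.
data _≺_ : BStr → BStr → Set where
  0≺1  : ∀ {xs ys} → false ∷ xs ≺ true ∷ ys
  cons : ∀ {b xs ys} → xs ≺ ys → b ∷ xs ≺ b ∷ ys

≺-irrefl : ∀ {xs} → ¬ xs ≺ xs
≺-irrefl (cons p) = ≺-irrefl p

≺-trans : ∀ {xs ys zs} → xs ≺ ys → ys ≺ zs → xs ≺ zs
≺-trans 0≺1 (cons q) = 0≺1
≺-trans (cons p) 0≺1 = 0≺1
≺-trans (cons p) (cons q) = cons (≺-trans p q)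

≺-++ : ∀ {xs ys} as bs → xs ≺ ys → xs ++ as ≺ ys ++ bs
≺-++ as bs 0≺1 = 0≺1
≺-++ as bs (cons p) = cons (≺-++ as bs p)

++-≺ : ∀ ps {xs ys} → xs ≺ ys → ps ++ xs ≺ ps ++ ys
++-≺ [] p = p
++-≺ (b ∷ ps) p = cons (++-≺ ps p)

++-≺⁻ : ∀ ps {xs ys} → ps ++ xs ≺ ps ++ ys → xs ≺ ys
++-≺⁻ [] p = p
++-≺⁻ (b ∷ ps) (cons p) = ++-≺⁻ ps p

≺-tri : ∀ xs ys → length xs ≡ length ys → xs ≺ ys ⊎ xs ≡ ys ⊎ ys ≺ xs
≺-tri [] [] e = inj₂ (inj₁ refl)
≺-tri (false ∷ xs) (true ∷ ys) e = inj₁ 0≺1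
≺-tri (true ∷ xs) (false ∷ ys) e = inj₂ (inj₂ 0≺1)
≺-tri (false ∷ xs) (false ∷ ys) e with ≺-tri xs ys (suc-injective e)
... | inj₁ p = inj₁ (cons p)
... | inj₂ (inj₁ p) = inj₂ (inj₁ (cong (false ∷_) p))
... | inj₂ (inj₂ p) = inj₂ (inj₂ (cons p))
≺-tri (true ∷ xs) (true ∷ ys) e with ≺-tri xs ys (suc-injective e)
... | inj₁ p = inj₁ (cons p)
... | inj₂ (inj₁ p) = inj₂ (inj₁ (cong (true ∷_) p))
... | inj₂ (inj₂ p) = inj₂ (inj₂ (cons p))

≺-split : ∀ xs ys {as bs} → length xs ≡ length ys → xs ++ as ≺ ys ++ bs → xs ≺ ys ⊎ (xs ≡ ys × as ≺ bs)
≺-split [] [] e p = inj₂ (refl , p)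
≺-split (x ∷ xs) (y ∷ ys) e 0≺1 = inj₁ 0≺1
≺-split (x ∷ xs) (y ∷ ys) e (cons p) with ≺-split xs ys (suc-injective e) p
... | inj₁ q = inj₁ (cons q)
... | inj₂ (q , h) = inj₂ (cong (x ∷_) q , h)

≤ᵇ⇒⊀ : ∀ xs ys → T (xs ≤ᵇ ys) → ¬ ys ≺ xs
≤ᵇ⇒⊀ (false ∷ xs) (false ∷ ys) t (cons p) = ≤ᵇ⇒⊀ xs ys t p
≤ᵇ⇒⊀ (true ∷ xs) (true ∷ ys) t (cons p) = ≤ᵇ⇒⊀ xs ys t p

-- Equal lengths exclude that `ys` is a proper prefix of `xs`, a case which `≺` does not compare.
⊀⇒≤ᵇ : ∀ xs ys → length xs ≡ length ys → ¬ ys ≺ xs → T (xs ≤ᵇ ys)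
⊀⇒≤ᵇ [] ys e n = _
⊀⇒≤ᵇ (false ∷ xs) (false ∷ ys) e n = ⊀⇒≤ᵇ xs ys (suc-injective e) (n ∘ cons)
⊀⇒≤ᵇ (true ∷ xs) (true ∷ ys) e n = ⊀⇒≤ᵇ xs ys (suc-injective e) (n ∘ cons)
⊀⇒≤ᵇ (false ∷ xs) (true ∷ ys) e n = _
⊀⇒≤ᵇ (true ∷ xs) (false ∷ ys) e n = ⊥-elim (n 0≺1)

≤ᵇ-refl : ∀ xs → T (xs ≤ᵇ xs)
≤ᵇ-refl xs = ⊀⇒≤ᵇ xs xs refl ≺-irrefl

≤ᵇ-trans : ∀ xs ys zs → T (xs ≤ᵇ ys) → T (ys ≤ᵇ zs) → T (xs ≤ᵇ zs)
≤ᵇ-trans [] ys zs p q = _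
≤ᵇ-trans (false ∷ xs) (false ∷ ys) (false ∷ zs) p q = ≤ᵇ-trans xs ys zs p q
≤ᵇ-trans (false ∷ xs) (false ∷ ys) (true ∷ zs) p q = _
≤ᵇ-trans (false ∷ xs) (true ∷ ys) (true ∷ zs) p q = _
≤ᵇ-trans (true ∷ xs) (true ∷ ys) (true ∷ zs) p q = ≤ᵇ-trans xs ys zs p q

≤ᵇ-antisym : ∀ xs ys → T (xs ≤ᵇ ys) → T (ys ≤ᵇ xs) → xs ≡ ys
≤ᵇ-antisym [] [] p q = refl
≤ᵇ-antisym (false ∷ xs) (false ∷ ys) p q = cong (false ∷_) (≤ᵇ-antisym xs ys p q)
≤ᵇ-antisym (true ∷ xs) (true ∷ ys) p q = cong (true ∷_) (≤ᵇ-antisym xs ys p q)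

≰ᵇ⇒≥ᵇ : ∀ xs ys → xs ≤ᵇ ys ≡ false → T (ys ≤ᵇ xs)
≰ᵇ⇒≥ᵇ (x ∷ xs) [] e = _
≰ᵇ⇒≥ᵇ (false ∷ xs) (false ∷ ys) e = ≰ᵇ⇒≥ᵇ xs ys e
≰ᵇ⇒≥ᵇ (true ∷ xs) (true ∷ ys) e = ≰ᵇ⇒≥ᵇ xs ys e
≰ᵇ⇒≥ᵇ (true ∷ xs) (false ∷ ys) e = _

==ᵇ⇒≡ : ∀ xs ys → T (xs ==ᵇ ys) → xs ≡ ys
==ᵇ⇒≡ [] [] t = refl
==ᵇ⇒≡ (false ∷ xs) (false ∷ ys) t = cong (false ∷_) (==ᵇ⇒≡ xs ys t)
==ᵇ⇒≡ (true ∷ xs) (true ∷ ys) t = cong (true ∷_) (==ᵇ⇒≡ xs ys t)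

==ᵇ-refl : ∀ xs → T (xs ==ᵇ xs)
==ᵇ-refl [] = _
==ᵇ-refl (false ∷ xs) = ==ᵇ-refl xs
==ᵇ-refl (true ∷ xs) = ==ᵇ-refl xs

-- Rotations

Rotation : BStr → BStr → Set
Rotation α β = ∃[ u ] ∃[ v ] (α ≡ u ++ v × β ≡ v ++ u)

Rotation-trans : ∀ {α β γ} → Rotation α β → Rotation β γ → Rotation α γ
Rotation-trans (u , v , refl , refl) (a , b , e , refl) with ++-split v u a b e
... | inj₁ (w , refl , refl) = w , b ++ v , ++-assoc w b v , sym (++-assoc b v w)
... | inj₂ (c , w , refl , refl) = u ++ a , c ∷ w , sym (++-assoc u a (c ∷ w)) , ++-assoc (c ∷ w) u a

Rotation-sym : ∀ {α β} → Rotation α β → Rotation β α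
Rotation-sym (u , v , p , q) = v , u , q , p

Rotation-length : ∀ {α β} → Rotation α β → length α ≡ length β
Rotation-length (u , v , refl , refl) = length-++-comm u v

drop-length-++ : ∀ (u v : BStr) → drop (length u) (u ++ v) ≡ v
drop-length-++ [] v = refl
drop-length-++ (x ∷ u) v = drop-length-++ u v

take-length-++ : ∀ (u v : BStr) → take (length u) (u ++ v) ≡ u
take-length-++ [] v = refl
take-length-++ (x ∷ u) v = cong (x ∷_) (take-length-++ u v)

∈-rotations⁻ : ∀ {α β} → β ∈ rotations α → Rotation α β
∈-rotations⁻ {α} β∈ with k , _ , refl ← ∈-map⁻ (λ k → rotate k α) β∈ = take k α , drop k α , sym (take++drop≡id k α) , refl

-- The empty string has an empty list of rotations.
∈-rotations⁺ : ∀ {α β} → α ≢ [] → Rotation α β → β ∈ rotations α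
∈-rotations⁺ {[]} α≢[] _ = ⊥-elim (α≢[] refl)
-- The cut at the very end would need an index outside the list; index 0 gives the same rotation.
∈-rotations⁺ {a ∷ α} _ (u , [] , e , refl) =
  subst (_∈ rotations (a ∷ α)) (trans (++-identityʳ (a ∷ α)) (trans e (++-identityʳ u)))
    (∈-map⁺ (λ k → rotate k (a ∷ α)) (∈-upTo⁺ {suc (length α)} (s≤s z≤n)))
∈-rotations⁺ {a ∷ α} _ (u , v@(c ∷ w) , e , refl) =
  subst (_∈ rotations (a ∷ α)) eq (∈-map⁺ (λ k → rotate k (a ∷ α)) (∈-upTo⁺ lt))
  where
  lt : length u < length (a ∷ α)
  lt = subst (length u <_) (sym (trans (cong length e) (length-++ u))) (m<m+n (length u) (s≤s z≤n))
  eq : rotate (length u) (a ∷ α) ≡ v ++ u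
  eq = trans (cong (rotate (length u)) e) (cong₂ _++_ (drop-length-++ u v) (take-length-++ u v))

-- This is the anonymous function folded in `neck`, named so that the fold admits induction over its
-- starting value.
minᵇ : BStr → BStr → BStr
minᵇ best γ = if γ ≤ᵇ best then γ else best

minᵇ-≤ : ∀ best γ → T (minᵇ best γ ≤ᵇ best) × T (minᵇ best γ ≤ᵇ γ) × (minᵇ best γ ≡ best ⊎ minᵇ best γ ≡ γ)
minᵇ-≤ best γ with γ ≤ᵇ best in e
... | true = Equivalence.from T-≡ e , ≤ᵇ-refl γ , inj₂ refl
... | false = ≤ᵇ-refl best , ≰ᵇ⇒≥ᵇ γ best e , inj₁ refl

foldl-minᵇ-≤ : ∀ best γs γ → γ ∈ best ∷ γs → T (foldl minᵇ best γs ≤ᵇ γ)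
foldl-minᵇ-≤ best [] γ (here refl) = ≤ᵇ-refl best
foldl-minᵇ-≤ best (γ′ ∷ γs) γ m with minᵇ-≤ best γ′ | foldl-minᵇ-≤ (minᵇ best γ′) γs
foldl-minᵇ-≤ best (γ′ ∷ γs) γ (here refl) | p , _ , _ | ih =
  ≤ᵇ-trans (foldl minᵇ (minᵇ best γ′) γs) (minᵇ best γ′) γ (ih _ (here refl)) p
foldl-minᵇ-≤ best (γ′ ∷ γs) γ (there (here refl)) | _ , p , _ | ih =
  ≤ᵇ-trans (foldl minᵇ (minᵇ best γ′) γs) (minᵇ best γ′) γ (ih _ (here refl)) p
foldl-minᵇ-≤ best (γ′ ∷ γs) γ (there (there m)) | _ | ih = ih γ (there m)

foldl-minᵇ-∈ : ∀ best γs → foldl minᵇ best γs ∈ best ∷ γs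
foldl-minᵇ-∈ best [] = here refl
foldl-minᵇ-∈ best (γ ∷ γs) with foldl-minᵇ-∈ (minᵇ best γ) γs | minᵇ-≤ best γ
... | there m | _ = there (there m)
... | here e | _ , _ , inj₁ e′ = here (trans e e′)
... | here e | _ , _ , inj₂ e′ = there (here (trans e e′))

neck-≤ : ∀ {β γ} → β ≢ [] → Rotation β γ → T (neck β ≤ᵇ γ)
neck-≤ {β} {γ} β≢[] ρ = foldl-minᵇ-≤ β (rotations β) γ (there (∈-rotations⁺ β≢[] ρ))

neck-rotation : ∀ β → Rotation β (neck β)
neck-rotation β with foldl-minᵇ-∈ β (rotations β)
... | here e = [] , β , refl , trans e (sym (++-identityʳ β))
... | there m = ∈-rotations⁻ m

-- Asymmetric bracelets

-- The strings reverse u ++ reverse v with α ≡ u ++ v are the rotations of reverse α.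
record Asym (α : BStr) : Set where
  field
    ⊀-rotation  : ∀ u v → α ≡ u ++ v → ¬ v ++ u ≺ α
    ≺-reflected : ∀ u v → α ≡ u ++ v → α ≺ reverse u ++ reverse v

open Asym

reflected-rotation : ∀ u v → Rotation (reverse (u ++ v)) (reverse u ++ reverse v)
reflected-rotation u v = reverse v , reverse u , reverse-++ u v , refl

Rotation-reverse⁻ : ∀ {α β} → Rotation (reverse α) β → ∃[ u ] ∃[ v ] (α ≡ u ++ v × β ≡ reverse u ++ reverse v)
Rotation-reverse⁻ {α} (a , b , e , refl) =
  reverse b , reverse a , trans (reverse-swap e) (reverse-++ a b)
  , cong₂ _++_ (sym (reverse-involutive b)) (sym (reverse-involutive a))

reverse-≢[] : ∀ {α : BStr} → α ≢ [] → reverse α ≢ []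
reverse-≢[] α≢[] e = α≢[] (reverse-swap e)

-- Strictness in `≺-reflected` serves twice: it gives minimality among the rotations of the
-- reversal, and it excludes symmetry, under which `α` would itself be one of them.
Asym⇒A : ∀ {n α} → length α ≡ n → Asym α → A n α
Asym⇒A {n} {α} len h = Equivalence.from T-∧ (≡⇒≡ᵇ (length α) n len , Equivalence.from T-∧ (bracelet , asymmetric))
  where
  bracelet : T (isBracelet α)
  bracelet = all⁻ (α ≤ᵇ_) (tabulate (λ m → case ∈-++⁻ (rotations α) m of λ
    { (inj₁ m₁) → let (u , v , e , e′) = ∈-rotations⁻ m₁ in
        ⊀⇒≤ᵇ α _ (Rotation-length (∈-rotations⁻ m₁)) (subst (λ β → ¬ β ≺ α) (sym e′) (⊀-rotation h u v e))
    ; (inj₂ m₂) → let (u , v , e , e′) = Rotation-reverse⁻ (∈-rotations⁻ m₂) in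
        ⊀⇒≤ᵇ α _ (trans (sym (length-reverse α)) (Rotation-length (∈-rotations⁻ m₂)))
          (λ p → ≺-irrefl (≺-trans p (subst (α ≺_) (sym e′) (≺-reflected h u v e)))) }))
  symmetric⇒⊥ : ¬ T (isSymmetric α)
  symmetric⇒⊥ t with β , m , t′ ← find (any⁻ (_==ᵇ reverse α) (rotations α) t) with refl ← ==ᵇ⇒≡ β (reverse α) t′
    with u , v , e , e′ ← Rotation-reverse⁻ (Rotation-sym (∈-rotations⁻ m)) =
    ≺-irrefl (subst (α ≺_) (sym e′) (≺-reflected h u v e))
  asymmetric : T (not (isSymmetric α))
  asymmetric with isSymmetric α | symmetric⇒⊥
  ... | false | _ = _
  ... | true | f = f _

-- The length is a successor because the empty string, whose list of rotations is empty, passes the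
-- test for `A 0` although `Asym []` is false.
A⇒Asym : ∀ {n α} → A (suc n) α → length α ≡ suc n × Asym α
A⇒Asym {n} {α} a with p , q ← Equivalence.to (T-∧ {length α ≡ᵇ suc n}) a
  with b , ns ← Equivalence.to (T-∧ {isBracelet α}) q = len , record { ⊀-rotation = rot ; ≺-reflected = refl-rot }
  where
  len : length α ≡ suc n
  len = ≡ᵇ⇒≡ (length α) (suc n) p
  α≢[] : α ≢ []
  α≢[] refl with () ← len
  minimal : ∀ {β} → β ∈ rotations α ++ rotations (reverse α) → T (α ≤ᵇ β)
  minimal = lookup (all⁺ (α ≤ᵇ_) _ b)
  rot : ∀ u v → α ≡ u ++ v → ¬ v ++ u ≺ α
  rot u v e = ≤ᵇ⇒⊀ α (v ++ u) (minimal (∈-++⁺ˡ (∈-rotations⁺ α≢[] (u , v , e , refl))))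
  refl-rot : ∀ u v → α ≡ u ++ v → α ≺ reverse u ++ reverse v
  refl-rot u v refl with ≺-tri α (reverse u ++ reverse v)
      (trans (sym (length-reverse α)) (Rotation-length (reflected-rotation u v)))
  ... | inj₁ lt = lt
  ... | inj₂ (inj₁ e) = ⊥-elim (subst T (Equivalence.to T-not-≡ ns) (any⁺ (_==ᵇ reverse α) (lose {P = λ β → T (β ==ᵇ reverse α)}
      (∈-rotations⁺ α≢[] (subst (λ β → Rotation β (reverse α)) (sym e) (Rotation-sym (reflected-rotation u v)))) (==ᵇ-refl (reverse α)))))
  ... | inj₂ (inj₂ gt) = ⊥-elim (≤ᵇ⇒⊀ α _
      (minimal (∈-++⁺ʳ (rotations α) (∈-rotations⁺ (reverse-≢[] α≢[]) (reflected-rotation u v)))) gt)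

-- Strings whose initial run of zeros is the longest

zeros-longer : ∀ s x y → zeros (suc s) ++ x ≺ zeros s ++ true ∷ y
zeros-longer zero x y = 0≺1
zeros-longer (suc s) x y = cons (zeros-longer s x y)

-- The 1 after `d` ends any shorter run: unless `d` supplies all `p` zeros, the comparison with 0^p
-- stops at a 1, and that 1 makes the string larger.
zeros-prefix-or-≺ : ∀ p d e y → (∃[ d′ ] d ≡ zeros p ++ d′) ⊎ zeros p ++ y ≺ d ++ true ∷ e
zeros-prefix-or-≺ zero d e y = inj₁ (d , refl)
zeros-prefix-or-≺ (suc p) [] e y = inj₂ 0≺1
zeros-prefix-or-≺ (suc p) (true ∷ d) e y = inj₂ 0≺1
zeros-prefix-or-≺ (suc p) (false ∷ d) e y with zeros-prefix-or-≺ p d e y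
... | inj₁ (d′ , h) = inj₁ (d′ , cong (false ∷_) h)
... | inj₂ h = inj₂ (cons h)

zeros-comm : ∀ i j → zeros i ++ zeros j ≡ zeros j ++ zeros i
zeros-comm i j = trans (sym (replicate-+ i j false)) (trans (cong zeros (+-comm i j)) (replicate-+ j i false))

true≺⇒head : ∀ {xs ys} → true ∷ xs ≺ ys → ∃[ zs ] ys ≡ true ∷ zs
true≺⇒head (cons {ys = zs} _) = zs , refl

∷ʳ-assoc : ∀ (x y : BStr) b → (x ++ y) ∷ʳ b ≡ x ++ y ∷ʳ b
∷ʳ-assoc x y b = ++-assoc x y (b ∷ [])

-- The initial run of zeros is the only one of length p, so a rotation of the string or of its
-- reversal can compete with it only if it starts with that run.
longest-run-Asym : ∀ p δ → true ∷ δ ≺ reverse (true ∷ δ) → (∀ a b → true ∷ δ ≢ a ++ zeros p ++ b) →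
  Asym (zeros p ++ true ∷ δ)
longest-run-Asym p δ δ≺ no-run = record { ⊀-rotation = rot ; ≺-reflected = ref }
  where
  D = true ∷ δ
  ε : BStr
  ε = proj₁ (true≺⇒head δ≺)
  reverse-D : reverse D ≡ true ∷ ε
  reverse-D = proj₂ (true≺⇒head δ≺)

  -- `D` ends in 1 because its reversal starts with 1; a nonempty suffix thus supplies the 1 that
  -- `zeros-prefix-or-≺` asks for.
  suffix-end : ∀ x v → D ≡ x ++ v → v ≡ [] ⊎ (∃[ v′ ] v ≡ v′ ∷ʳ true)
  suffix-end x v e with initLast v
  ... | [] = inj₁ refl
  ... | v′ ∷ʳ′ b = inj₂ (v′ , cong (v′ ∷ʳ_) (∷ʳ-injectiveʳ (x ++ v′) (reverse ε)
    (trans (∷ʳ-assoc x v′ b) (trans (sym e) (trans (reverse-swap reverse-D) (unfold-reverse true ε))))))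

  rot : ∀ u v → zeros p ++ D ≡ u ++ v → ¬ v ++ u ≺ zeros p ++ D
  rot u v e lt with ++-split u v (zeros p) D (sym e)
  -- The cut lies in the initial run. Once the common 0^j is cancelled, `D` 0^i faces 0^i `D`, which
  -- starts with 0 unless i = 0.
  rot u v e lt | inj₁ (w , e₁ , refl) with i , j , refl , refl ← replicate-++⁻ p u w e₁ =
    D⊀ i (++-≺⁻ (zeros j) (subst₂ _≺_ (++-assoc (zeros j) D (zeros i))
      (trans (cong (_++ D) (trans e₁ (zeros-comm i j))) (++-assoc (zeros j) (zeros i) D)) lt))
    where
    D⊀ : ∀ i → ¬ D ++ zeros i ≺ zeros i ++ D
    D⊀ zero h = ≺-irrefl (subst (_≺ D) (++-identityʳ D) h)
  rot u v e lt | inj₂ (b , c , refl , e₂) with suffix-end (b ∷ c) v e₂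
  ... | inj₁ refl = ≺-irrefl (subst (zeros p ++ b ∷ c ≺_) (cong (zeros p ++_) (trans e₂ (++-identityʳ (b ∷ c)))) lt)
  ... | inj₂ (v′ , refl) with zeros-prefix-or-≺ p v′ (zeros p ++ b ∷ c) D
  ...   | inj₁ (v″ , refl) = no-run (b ∷ c) (v″ ∷ʳ true) (trans e₂ (cong ((b ∷ c) ++_) (∷ʳ-assoc (zeros p) v″ true)))
  ...   | inj₂ gt = ≺-irrefl (≺-trans gt (subst (_≺ zeros p ++ D) (∷ʳ-++ v′ true (zeros p ++ b ∷ c)) lt))

  ref : ∀ u v → zeros p ++ D ≡ u ++ v → zeros p ++ D ≺ reverse u ++ reverse v
  ref u v e with ++-split u v (zeros p) D (sym e)
  ref u v e | inj₁ (w , e₁ , refl) with i , j , refl , refl ← replicate-++⁻ p u w e₁ =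
    subst₂ _≺_ (sym (trans (cong (_++ D) e₁) (++-assoc (zeros i) (zeros j) D)))
      (cong₂ _++_ (sym (reverse-replicate i false)) (sym (trans (reverse-++ (zeros j) D) (cong (reverse D ++_) (reverse-replicate j false)))))
      (++-≺ (zeros i) (≺-rev j))
    where
    ≺-rev : ∀ j → zeros j ++ D ≺ reverse D ++ zeros j
    ≺-rev zero = subst (D ≺_) (sym (++-identityʳ (reverse D))) δ≺
    ≺-rev (suc j) = subst (λ x → zeros (suc j) ++ D ≺ x ++ zeros (suc j)) (sym reverse-D) 0≺1
  -- The cut lies inside `D`, whose first 1 now follows the reversal of `c`. If that reversal
  -- started with 0^p, then `D` would contain this run.
  ref u v e | inj₂ (b , c , refl , refl) = subst (zeros p ++ D ≺_) eq lt
    where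
    open ≡-Reasoning
    eq : reverse c ++ true ∷ (zeros p ++ reverse v) ≡ reverse (zeros p ++ true ∷ c) ++ reverse v
    eq = begin
      reverse c ++ true ∷ (zeros p ++ reverse v)           ≡⟨ ∷ʳ-++ (reverse c) true _ ⟨
      reverse c ∷ʳ true ++ (zeros p ++ reverse v)          ≡⟨ ++-assoc (reverse c ∷ʳ true) (zeros p) (reverse v) ⟨
      (reverse c ∷ʳ true ++ zeros p) ++ reverse v          ≡⟨ cong (_++ reverse v) (cong₂ _++_ (sym (unfold-reverse true c)) (sym (reverse-replicate p false))) ⟩
      (reverse (true ∷ c) ++ reverse (zeros p)) ++ reverse v ≡⟨ cong (_++ reverse v) (reverse-++ (zeros p) (true ∷ c)) ⟨
      reverse (zeros p ++ true ∷ c) ++ reverse v           ∎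
    lt : zeros p ++ D ≺ reverse c ++ true ∷ (zeros p ++ reverse v)
    lt with zeros-prefix-or-≺ p (reverse c) (zeros p ++ reverse v) D
    ... | inj₂ h = h
    ... | inj₁ (d , h) = ⊥-elim (no-run (true ∷ reverse d) v (cong (true ∷_) (begin
      c ++ v                                 ≡⟨ cong (_++ v) (reverse-swap h) ⟩
      reverse (zeros p ++ d) ++ v            ≡⟨ cong (_++ v) (reverse-++ (zeros p) d) ⟩
      (reverse d ++ reverse (zeros p)) ++ v  ≡⟨ cong (λ x → (reverse d ++ x) ++ v) (reverse-replicate p false) ⟩
      (reverse d ++ zeros p) ++ v            ≡⟨ ++-assoc (reverse d) (zeros p) v ⟩
      reverse d ++ zeros p ++ v              ∎)))

-- Rotating a longer run of zeros to the front would give a smaller string.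
Asym-no-longer-run : ∀ s τ → Asym (zeros s ++ true ∷ τ) → ∀ a b → zeros s ++ true ∷ τ ≢ a ++ zeros (suc s) ++ b
Asym-no-longer-run s τ h a b e =
  ⊀-rotation h a (zeros (suc s) ++ b) e (subst (_≺ zeros s ++ true ∷ τ) (sym (++-assoc (zeros (suc s)) b a)) (zeros-longer s (b ++ a) τ))

-- The extension `z′` allows for the longer run 0^(s+1+t) of `firstOne-Asym`; in `lastOne-Asym` it
-- is empty.
no-run-suffix : ∀ {α} (p δ q z z′ : BStr) → (∀ a b → α ≢ a ++ z ++ b) → α ≡ p ++ δ ++ q → ∀ a b → δ ≢ a ++ (z ++ z′) ++ b
no-run-suffix p δ q z z′ no-run refl a b refl = no-run (p ++ a) (z′ ++ b ++ q) (begin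
  p ++ (a ++ (z ++ z′) ++ b) ++ q  ≡⟨ cong (p ++_) (++-assoc a _ q) ⟩
  p ++ a ++ ((z ++ z′) ++ b) ++ q  ≡⟨ ++-assoc p a _ ⟨
  (p ++ a) ++ ((z ++ z′) ++ b) ++ q ≡⟨ cong ((p ++ a) ++_) (trans (++-assoc (z ++ z′) b q) (++-assoc z z′ (b ++ q))) ⟩
  (p ++ a) ++ z ++ z′ ++ b ++ q    ∎)
  where open ≡-Reasoning

Asym-tail-≺-reverse : ∀ s τ → Asym (zeros s ++ τ) → τ ≺ reverse τ
Asym-tail-≺-reverse s τ h =
  ++-≺⁻ (zeros s) (subst (λ x → zeros s ++ τ ≺ x ++ reverse τ) (reverse-replicate s false) (≺-reflected h (zeros s) τ refl))

¬Asym-true∷ : ∀ τ → ¬ Asym (true ∷ τ)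
¬Asym-true∷ τ h with ones-or-last-zero (true ∷ τ)
... | inj₁ (k , e) = ≺-irrefl (subst (true ∷ τ ≺_)
  (trans (cong reverse e) (trans (reverse-replicate k true) (sym e))) (≺-reflected h [] (true ∷ τ) refl))
... | inj₂ (μ , j , e) = ⊀-rotation h μ (false ∷ ones j) e 0≺1

Asym-form : ∀ {α} → Asym α → ∃[ s ] ∃[ τ ] α ≡ zeros (suc s) ++ true ∷ τ
Asym-form {α} h with zeros-or-one α
... | inj₁ (k , refl) = ⊥-elim (≺-irrefl (subst (zeros k ≺_) (reverse-replicate k false) (≺-reflected h [] (zeros k) refl)))
... | inj₂ (zero , τ , refl) = ⊥-elim (¬Asym-true∷ τ h)
... | inj₂ (suc s , τ , e) = s , τ , e

-- The three moves

firstOne-zeros : ∀ s τ → firstOne (zeros s ++ true ∷ τ) ≡ zeros (suc s) ++ τ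
firstOne-zeros zero τ = refl
firstOne-zeros (suc s) τ = cong (false ∷_) (firstOne-zeros s τ)

-- Flipping the first 1 merges 0^s, the new 0 and 0^t into one run, longer than every run of the old
-- string, so `longest-run-Asym` applies.
firstOne-Asym : ∀ s t β → Asym (zeros s ++ true ∷ zeros t ++ true ∷ β) → true ∷ β ≺ reverse (true ∷ β) →
  Asym (firstOne (zeros s ++ true ∷ zeros t ++ true ∷ β))
firstOne-Asym s t β h β≺ =
  subst Asym (sym (trans (firstOne-zeros s _) (sym eq)))
    (longest-run-Asym (suc s + t) β β≺ no-run)
  where
  split : zeros (suc s + t) ≡ zeros (suc s) ++ zeros t
  split = replicate-+ (suc s) t false
  eq : zeros (suc s + t) ++ true ∷ β ≡ zeros (suc s) ++ zeros t ++ true ∷ β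
  eq = trans (cong (_++ true ∷ β) split) (++-assoc (zeros (suc s)) (zeros t) (true ∷ β))
  no-run : ∀ a b → true ∷ β ≢ a ++ zeros (suc s + t) ++ b
  no-run a b e = no-run-suffix (zeros s ++ true ∷ zeros t) (true ∷ β) [] (zeros (suc s)) (zeros t)
    (Asym-no-longer-run s _ h)
    (trans (sym (++-assoc (zeros s) (true ∷ zeros t) (true ∷ β))) (cong ((zeros s ++ true ∷ zeros t) ++_) (sym (++-identityʳ (true ∷ β)))))
    a b (trans e (cong (λ z → a ++ z ++ b) split))

lastTo0-∷ʳ : ∀ x b → lastTo0 (x ∷ʳ b) ≡ x ∷ʳ false
lastTo0-∷ʳ [] b = refl
lastTo0-∷ʳ (a ∷ []) b = refl
lastTo0-∷ʳ (a ∷ c ∷ x) b = cong (a ∷_) (lastTo0-∷ʳ (c ∷ x) b)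

∷ʳ-≢[] : ∀ (x : BStr) b → x ∷ʳ b ≢ []
∷ʳ-≢[] [] b ()
∷ʳ-≢[] (_ ∷ _) b ()

lastOne-rotation : ∀ x b → Rotation (false ∷ x) (lastOne (x ∷ʳ b))
lastOne-rotation x b = subst (λ β → Rotation (false ∷ x) (neck β)) (sym (lastTo0-∷ʳ x b))
  (Rotation-trans (false ∷ [] , x , refl , refl) (neck-rotation (x ∷ʳ false)))

lastOne-≤ : ∀ x b → T (lastOne (x ∷ʳ b) ≤ᵇ (false ∷ x))
lastOne-≤ x b = subst (λ β → T (neck β ≤ᵇ (false ∷ x))) (sym (lastTo0-∷ʳ x b))
  (neck-≤ (∷ʳ-≢[] x false) (x , false ∷ [] , refl , refl))

-- The new final 0, moved to the front, makes the initial run the longest. The rotation so obtained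
-- is an asymmetric bracelet, hence the smallest rotation, hence the necklace itself.
lastOne-Asym : ∀ s ρ → Asym (zeros s ++ (true ∷ ρ) ∷ʳ true) → true ∷ ρ ≺ reverse (true ∷ ρ) →
  Asym (lastOne (zeros s ++ (true ∷ ρ) ∷ʳ true))
lastOne-Asym s ρ h ρ≺ = subst Asym ν≡ ν-Asym
  where
  x = zeros s ++ true ∷ ρ
  ν-Asym : Asym (false ∷ x)
  ν-Asym = longest-run-Asym (suc s) ρ ρ≺ (λ a b e → no-run-suffix (zeros s) (true ∷ ρ) (true ∷ []) (zeros (suc s)) []
    (Asym-no-longer-run s _ h) refl a b (trans e (cong (λ z → a ++ z ++ b) (sym (++-identityʳ (zeros (suc s)))))))
  ν≡ : false ∷ x ≡ lastOne (zeros s ++ (true ∷ ρ) ∷ʳ true)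
  ν≡ with u , v , e , e′ ← lastOne-rotation x true = trans (≤ᵇ-antisym (false ∷ x) (lastOne (x ∷ʳ true))
      (⊀⇒≤ᵇ (false ∷ x) _ (Rotation-length (lastOne-rotation x true)) (λ lt → ⊀-rotation ν-Asym u v e (subst (_≺ false ∷ x) e′ lt)))
      (lastOne-≤ x true)) (cong lastOne (∷ʳ-assoc (zeros s) (true ∷ ρ) true))

-- The local function of lastZero has no name outside Defs; unification recovers it.
mutual
  flipFirstZero : BStr → BStr → BStr
  flipFirstZero = _

  lastZero-flip : ∀ α → lastZero α ≡ reverse (flipFirstZero α (reverse α))
  lastZero-flip α with reverse α
  ... | w with reverse {A = Bool}
  ...   | R = refl

flipFirstZero-ones : ∀ α j xs → flipFirstZero α (ones j ++ false ∷ xs) ≡ ones j ++ true ∷ xs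
flipFirstZero-ones α zero xs = refl
flipFirstZero-ones α (suc j) xs = cong (true ∷_) (flipFirstZero-ones α j xs)

reverse-++-ones : ∀ μ b j → reverse (μ ++ b ∷ ones j) ≡ ones j ++ b ∷ reverse μ
reverse-++-ones μ b j = begin
  reverse (μ ++ b ∷ ones j)               ≡⟨ reverse-++ μ (b ∷ ones j) ⟩
  reverse (b ∷ ones j) ++ reverse μ       ≡⟨ cong (_++ reverse μ) (unfold-reverse b (ones j)) ⟩
  reverse (ones j) ∷ʳ b ++ reverse μ      ≡⟨ ∷ʳ-++ (reverse (ones j)) b (reverse μ) ⟩
  reverse (ones j) ++ b ∷ reverse μ       ≡⟨ cong (_++ b ∷ reverse μ) (reverse-replicate j true) ⟩
  ones j ++ b ∷ reverse μ                 ∎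
  where open ≡-Reasoning

lastZero-ones : ∀ μ j → lastZero (μ ++ false ∷ ones j) ≡ μ ++ true ∷ ones j
lastZero-ones μ j = begin
  lastZero α                                              ≡⟨ lastZero-flip α ⟩
  reverse (flipFirstZero α (reverse α))                   ≡⟨ cong (λ x → reverse (flipFirstZero α x)) (reverse-++-ones μ false j) ⟩
  reverse (flipFirstZero α (ones j ++ false ∷ reverse μ)) ≡⟨ cong reverse (flipFirstZero-ones α j (reverse μ)) ⟩
  reverse (ones j ++ true ∷ reverse μ)                    ≡⟨ reverse-swap (reverse-++-ones μ true j) ⟨
  μ ++ true ∷ ones j                                      ∎
  where
  open ≡-Reasoning
  α = μ ++ false ∷ ones j

ones-⊀ : ∀ m z → ¬ ones m ≺ z
ones-⊀ (suc m) (true ∷ z) (cons p) = ones-⊀ m z p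

-- If the two sides agree before position |w|, then `μ` has a 1 there, and lowering the bit after
-- `w` lets that position decide.
≺-lower : ∀ w μ {x y x′ y′} → length w < length μ → w ++ true ∷ x ≺ μ ++ true ∷ y → w ++ false ∷ x′ ≺ μ ++ false ∷ y′
≺-lower [] (true ∷ μ) lt p = 0≺1
≺-lower (a ∷ w) (m ∷ μ) lt 0≺1 = 0≺1
≺-lower (a ∷ w) (m ∷ μ) (s≤s lt) (cons p) = cons (≺-lower w μ lt p)

-- Strip the common leading ones. A 0 met in `w` is below the 1 opposite it; if `w` ends first, it
-- has fewer than `j` ones, since with exactly `j` there would remain `ones m` below `z`.
≺-raise : ∀ j m w z y z′ → w ++ false ∷ ones m ≺ ones j ++ false ∷ z →
  w ++ true ∷ y ≺ ones j ++ true ∷ z′ ⊎ (∃[ i ] (i < j × w ≡ ones i))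
≺-raise zero m [] z y z′ (cons p) = ⊥-elim (ones-⊀ m z p)
≺-raise zero m (false ∷ w) z y z′ p = inj₁ 0≺1
≺-raise (suc j) m [] z y z′ p = inj₂ (0 , s≤s z≤n , refl)
≺-raise (suc j) m (false ∷ w) z y z′ p = inj₁ 0≺1
≺-raise (suc j) m (true ∷ w) z y z′ (cons p) with ≺-raise j m w z y z′ p
... | inj₁ q = inj₁ (cons q)
... | inj₂ (i , i<j , e) = inj₂ (suc i , s≤s i<j , cong (true ∷_) e)

-- A rotation below the new string gives one below the old string by `≺-lower`. A reflection can
-- fail only at a palindromic prefix `u`, where `≺-raise` leaves the single exception that the
-- second hypothesis excludes.
lastZero-Asym : ∀ μ j → Asym ((false ∷ μ) ++ false ∷ ones j) →
  (∀ u i → false ∷ μ ≡ u ++ ones i → u ≡ reverse u → ¬ i < j) → Asym ((false ∷ μ) ++ true ∷ ones j)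
lastZero-Asym μ j h not-palindromic = record { ⊀-rotation = rot ; ≺-reflected = ref }
  where
  M = false ∷ μ
  γ = M ++ true ∷ ones j
  rot : ∀ u v → γ ≡ u ++ v → ¬ v ++ u ≺ γ
  rot u v e lt with ++-split u v M (true ∷ ones j) (sym e)
  rot [] v e lt | inj₁ (w , e₁ , e₂) = ≺-irrefl (subst (_≺ γ) (trans (++-identityʳ v) (sym e)) lt)
  rot u@(a ∷ u′) v e lt | inj₁ (w , e₁ , refl) =
    ⊀-rotation h u (w ++ false ∷ ones j) (trans (cong (_++ false ∷ ones j) e₁) (++-assoc u w _))
      (subst (_≺ M ++ false ∷ ones j) (sym (++-assoc w (false ∷ ones j) u))
        (≺-lower w M (subst (length w <_) (sym (trans (cong length e₁) (length-++ u))) (s≤s (m≤n+m (length w) (length u′))))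
          (subst (_≺ γ) (++-assoc w (true ∷ ones j) u) lt)))
  -- The cut lies in the final ones, so a nonempty `v` starts with 1 while `γ` starts with 0.
  rot u v e lt | inj₂ (b , w , e₁ , e₂) with _ , k , _ , refl ← replicate-++⁻ (suc j) (b ∷ w) v e₂ = ones⊀ k e lt
    where
    ones⊀ : ∀ k → γ ≡ u ++ ones k → ¬ ones k ++ u ≺ γ
    ones⊀ zero e lt = ≺-irrefl (subst (u ≺_) (trans e (++-identityʳ u)) lt)
  ref : ∀ u v → γ ≡ u ++ v → γ ≺ reverse u ++ reverse v
  ref u v e with ++-split u v M (true ∷ ones j) (sym e)
  ref u v e | inj₁ (w , e₁ , refl) = subst₂ _≺_ (sym e) (cong (reverse u ++_) (sym (reverse-++-ones w true j))) goal
    where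
    old : u ++ w ++ false ∷ ones j ≺ reverse u ++ ones j ++ false ∷ reverse w
    old = subst₂ _≺_ eq (cong (reverse u ++_) (reverse-++-ones w false j)) (≺-reflected h u (w ++ false ∷ ones j) eq)
      where
      eq : M ++ false ∷ ones j ≡ u ++ w ++ false ∷ ones j
      eq = trans (cong (_++ false ∷ ones j) e₁) (++-assoc u w _)
    goal : u ++ w ++ true ∷ ones j ≺ reverse u ++ ones j ++ true ∷ reverse w
    goal with ≺-split u (reverse u) (sym (length-reverse u)) old
    ... | inj₁ lt = ≺-++ _ _ lt
    ... | inj₂ (pal , lt) with ≺-raise j j w (reverse w) (ones j) (reverse w) lt
    ...   | inj₁ lt′ = subst (λ x → u ++ w ++ true ∷ ones j ≺ x ++ ones j ++ true ∷ reverse w) pal (++-≺ u lt′)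
    ...   | inj₂ (i , i<j , refl) = ⊥-elim (not-palindromic u i e₁ pal i<j)
  ref u v e | inj₂ (b , w , refl , e₂) with suc i , _ , refl , _ ← replicate-++⁻ (suc j) (b ∷ w) v e₂ =
    subst (λ x → γ ≺ x ++ reverse v) (sym (trans (reverse-++ M (ones (suc i))) (cong (_++ reverse M) (reverse-replicate (suc i) true)))) 0≺1

-- Strings where neither FirstOne nor LastOne applies

-- Here `τ` is what follows the first 1. What is negated is the hypothesis of `firstOne-Asym`, not
-- membership itself; `LastOneStuck` does the same for `lastOne-Asym`.
FirstOneStuck : BStr → Set
FirstOneStuck τ = ∀ t β → τ ≡ zeros t ++ true ∷ β → ¬ true ∷ β ≺ reverse (true ∷ β)

LastOneStuck : BStr → Set
LastOneStuck τ = ∀ ρ → true ∷ τ ≡ (true ∷ ρ) ∷ʳ true → ¬ true ∷ ρ ≺ reverse (true ∷ ρ)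

true∷-⊀-∷ʳ : ∀ β → ¬ true ∷ β ≺ β ∷ʳ true
true∷-⊀-∷ʳ [] (cons ())
true∷-⊀-∷ʳ (true ∷ β) (cons p) = true∷-⊀-∷ʳ β p

-- For B = 1β, the tail satisfies 1B ≺ B^R 1. If B^R were at most B, then 1B ≺ B1 would follow,
-- against `true∷-⊀-∷ʳ`.
adjacent-ones-≺ : ∀ s β → Asym (zeros s ++ true ∷ true ∷ β) → true ∷ β ≺ reverse (true ∷ β)
adjacent-ones-≺ s β h with ≺-tri B (reverse B) (sym (length-reverse B))
  where B = true ∷ β
... | inj₁ lt = lt
... | inj₂ (inj₁ e) = ⊥-elim (true∷-⊀-∷ʳ _ (subst (true ∷ true ∷ β ≺_)
  (trans (unfold-reverse true (true ∷ β)) (cong (_∷ʳ true) (sym e))) (Asym-tail-≺-reverse s _ h)))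
... | inj₂ (inj₂ gt) = ⊥-elim (true∷-⊀-∷ʳ _ (≺-trans
  (subst (true ∷ true ∷ β ≺_) (unfold-reverse true (true ∷ β)) (Asym-tail-≺-reverse s _ h)) (≺-++ (true ∷ []) (true ∷ []) gt)))

stuck-isolated-one : ∀ s τ → Asym (zeros s ++ true ∷ τ) → FirstOneStuck τ → ∃[ τ′ ] τ ≡ false ∷ τ′
stuck-isolated-one s [] h F = ⊥-elim (≺-irrefl (Asym-tail-≺-reverse s (true ∷ []) h))
stuck-isolated-one s (false ∷ τ) h F = τ , refl
stuck-isolated-one s (true ∷ τ) h F = ⊥-elim (F 0 τ refl (adjacent-ones-≺ s τ h))

∷ʳ-head-false : ∀ x {y z} → false ∷ y ≡ x ∷ʳ true ++ z → ∃[ x′ ] (x ≡ false ∷ x′ × y ≡ x′ ∷ʳ true ++ z)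
∷ʳ-head-false [] ()
∷ʳ-head-false (false ∷ x) e = x , refl , ∷-injectiveʳ e

ones-∷ʳ : ∀ x b j → (x ++ b ∷ ones j) ∷ʳ true ≡ x ++ b ∷ ones (suc j)
ones-∷ʳ x b j = trans (∷ʳ-assoc x (b ∷ ones j) true) (cong (λ y → x ++ b ∷ y) (trans (replicate-∷ʳ j true []) (++-identityʳ _)))

1011′ : BStr
1011′ = true ∷ false ∷ true ∷ true ∷ []

-- The first bits of `e` let FirstOne or LastOne apply or break the palindrome, unless e = 11g. In
-- that case the failure of FirstOne bounds g 1011 from below and a rotation bounds it from above.
¬palindrome-1011 : ∀ s e → Asym (zeros (suc s) ++ true ∷ false ∷ e ++ 1011′) →
  FirstOneStuck (false ∷ e ++ 1011′) → LastOneStuck (false ∷ e ++ 1011′) →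
  zeros (suc s) ++ true ∷ false ∷ e ≢ reverse (true ∷ false ∷ e) ++ zeros (suc s)
¬palindrome-1011 s [] h F L pal = F 1 (false ∷ true ∷ true ∷ []) refl (cons 0≺1)
¬palindrome-1011 s (false ∷ e) h F L pal =
  L (false ∷ false ∷ e ++ 101′) (cong (λ x → true ∷ false ∷ false ∷ x) (sym (∷ʳ-assoc e 101′ true)))
    (subst (true ∷ false ∷ false ∷ e ++ 101′ ≺_) (sym (reverse-++ (true ∷ false ∷ false ∷ e) 101′)) (cons (cons 0≺1)))
  where
  101′ = true ∷ false ∷ true ∷ []
¬palindrome-1011 s (true ∷ []) h F L ()
¬palindrome-1011 s (true ∷ false ∷ e) h F L pal =
  F 1 (false ∷ e ++ 1011′) refl (subst (true ∷ false ∷ e ++ 1011′ ≺_) (sym (reverse-++ (true ∷ false ∷ e) 1011′)) (cons 0≺1))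
¬palindrome-1011 s (true ∷ true ∷ g) h F L pal = contra s g refl h σ⊀01 v⊀σ pal
  where
  v = reverse (true ∷ false ∷ true ∷ true ∷ g)
  α = zeros (suc s) ++ 1011′ ++ g ++ 1011′
  σ⊀01 : ∀ w → w ≡ reverse (true ∷ true ∷ g) → ¬ g ++ 1011′ ≺ false ∷ true ∷ w
  σ⊀01 w refl lt = F 1 (true ∷ g ++ 1011′) refl
    (subst (true ∷ true ∷ g ++ 1011′ ≺_) (sym (reverse-++ (true ∷ true ∷ g) 1011′)) (cons (cons lt)))
  -- Read backwards, the palindromic prefix ends in 0^(s+1), which together with the final 1011
  -- repeats the start of the string; cyclically, `v` comes next.
  α≡ : α ≡ v ++ zeros (suc s) ++ 1011′
  α≡ = trans (sym (++-assoc (zeros (suc s)) (1011′ ++ g) 1011′)) (trans (cong (_++ 1011′) pal) (++-assoc v (zeros (suc s)) 1011′))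
  v⊀σ : ¬ v ≺ g ++ 1011′
  v⊀σ lt = ⊀-rotation h v (zeros (suc s) ++ 1011′) α≡
    (subst (_≺ α) (sym (++-assoc (zeros (suc s)) 1011′ v)) (++-≺ (zeros (suc s)) (++-≺ 1011′ lt)))
  contra : ∀ s g′ → g ≡ g′ → Asym (zeros (suc s) ++ 1011′ ++ g ++ 1011′) →
    (∀ w → w ≡ reverse (true ∷ true ∷ g) → ¬ g′ ++ 1011′ ≺ false ∷ true ∷ w) → ¬ v ≺ g′ ++ 1011′ →
    zeros (suc s) ++ 1011′ ++ g ≢ v ++ zeros (suc s)
  contra s g′ g≡ h σ⊀01 v⊀σ pal with ∷ʳ-head-false (reverse (false ∷ true ∷ true ∷ g))
    (trans pal (cong (_++ zeros (suc s)) (unfold-reverse true (false ∷ true ∷ true ∷ g))))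
  contra s [] refl h σ⊀01 v⊀σ () | _
  contra s (true ∷ g′) g≡ h σ⊀01 v⊀σ pal | x , x≡ , _ =
    v⊀σ (subst (_≺ true ∷ g′ ++ 1011′) (sym (trans (unfold-reverse true (false ∷ true ∷ true ∷ g)) (cong (_∷ʳ true) x≡))) 0≺1)
  contra s (false ∷ false ∷ g′) g≡ h σ⊀01 v⊀σ pal | _ = σ⊀01 _ refl (cons 0≺1)
  -- The run has at least two zeros, so `v` starts with 00, whereas the lower bound makes g 1011
  -- start with 01.
  contra (suc s) (false ∷ g′) g≡ h σ⊀01 v⊀σ pal | x , x≡ , e with ∷ʳ-head-false x e
  ... | x′ , refl , _ = v⊀σ (subst (_≺ false ∷ g′ ++ 1011′)
      (sym (trans (unfold-reverse true (false ∷ true ∷ true ∷ g)) (cong (_∷ʳ true) x≡))) (cons (head g′ σ⊀01)))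
    where
    head : ∀ g′ → (∀ w → w ≡ reverse (true ∷ true ∷ g) → ¬ (false ∷ g′) ++ 1011′ ≺ false ∷ true ∷ w) → false ∷ (x′ ∷ʳ true) ≺ g′ ++ 1011′
    head [] _ = 0≺1
    head (true ∷ g′) _ = 0≺1
    head (false ∷ g′) f = ⊥-elim (f _ refl (cons 0≺1))
  -- With a single leading zero, `v` is `R` followed by 01; the rotation starting at that 01 begins
  -- with 01010, below the initial 01011.
  contra zero (false ∷ g′) refl h σ⊀01 v⊀σ pal | _ = ⊀-rotation h R 0101011′ eq (cons (cons (cons (cons 0≺1))))
    where
    open ≡-Reasoning
    0101011′ = false ∷ true ∷ false ∷ 1011′
    R = reverse (true ∷ true ∷ g)
    eq : false ∷ 1011′ ++ g ++ 1011′ ≡ R ++ 0101011′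
    eq = begin
      (false ∷ 1011′ ++ g) ++ 1011′                    ≡⟨ cong (_++ 1011′) pal ⟩
      (v ++ false ∷ []) ++ 1011′                       ≡⟨ cong (λ x → (x ++ false ∷ []) ++ 1011′) (reverse-++ (true ∷ false ∷ []) (true ∷ true ∷ g)) ⟩
      ((R ++ false ∷ true ∷ []) ++ false ∷ []) ++ 1011′ ≡⟨ ++-assoc (R ++ false ∷ true ∷ []) (false ∷ []) 1011′ ⟩
      (R ++ false ∷ true ∷ []) ++ false ∷ 1011′        ≡⟨ ++-assoc R (false ∷ true ∷ []) (false ∷ 1011′) ⟩
      R ++ 0101011′                                    ∎

-- If `u` does not reach past the initial zeros, `μ` is empty and j > 2 would allow LastOne.
-- Otherwise `u` ends in 0^(s+1): i = 0 would create a longer run, j > 2 would again allow LastOne,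
-- and i = 1, j = 2 is `¬palindrome-1011`.
palindromic-stuck⇒root : ∀ s μ j → Asym (zeros (suc s) ++ true ∷ μ ++ false ∷ ones j) →
  FirstOneStuck (μ ++ false ∷ ones j) → LastOneStuck (μ ++ false ∷ ones j) →
  ∀ u i → zeros (suc s) ++ true ∷ μ ≡ u ++ ones i → u ≡ reverse u → i < j → μ ≡ [] × j ≡ 2
palindromic-stuck⇒root s μ j h F L u i e pal i<j = go (++-split u (ones i) Z (true ∷ μ) (sym e))
  where
  Z = zeros (suc s)
  isolated : ∀ {ν} → μ ≡ true ∷ ν → ⊥
  isolated refl with () ← proj₂ (stuck-isolated-one (suc s) _ h F)

  leading : ∀ i j → ones i ≡ true ∷ μ → i < j → LastOneStuck (μ ++ false ∷ ones j) → μ ≡ [] × j ≡ 2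
  leading (suc (suc i)) j e i<j L = ⊥-elim (isolated (sym (∷-injectiveʳ e)))
  leading (suc zero) (suc (suc zero)) refl i<j L = refl , refl
  leading (suc zero) (suc zero) refl (s≤s ()) L
  leading (suc zero) (suc (suc (suc j))) refl i<j L = ⊥-elim (L (false ∷ ones (2 + j)) (sym (ones-∷ʳ (true ∷ []) false (2 + j)))
    (subst (true ∷ false ∷ ones (2 + j) ≺_) (sym (reverse-++-ones (true ∷ []) false (2 + j))) (cons 0≺1)))

  inner : ∀ e′ i j → μ ≡ e′ ++ ones i → Z ++ true ∷ e′ ≡ reverse (true ∷ e′) ++ Z → i < j →
    Asym (Z ++ true ∷ μ ++ false ∷ ones j) → FirstOneStuck (μ ++ false ∷ ones j) → LastOneStuck (μ ++ false ∷ ones j) → ⊥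
  inner e′ zero j refl pal i<j h F L = Asym-no-longer-run (suc s) _ h (reverse (true ∷ e′)) (ones j) (begin
    Z ++ true ∷ (e′ ++ []) ++ false ∷ ones j        ≡⟨ cong (λ x → Z ++ true ∷ x ++ false ∷ ones j) (++-identityʳ e′) ⟩
    Z ++ true ∷ e′ ++ false ∷ ones j                ≡⟨ ++-assoc Z (true ∷ e′) (false ∷ ones j) ⟨
    (Z ++ true ∷ e′) ++ false ∷ ones j              ≡⟨ cong (_++ false ∷ ones j) pal ⟩
    (reverse (true ∷ e′) ++ Z) ++ false ∷ ones j    ≡⟨ ++-assoc (reverse (true ∷ e′)) Z (false ∷ ones j) ⟩
    reverse (true ∷ e′) ++ Z ++ false ∷ ones j      ≡⟨ cong (reverse (true ∷ e′) ++_) (replicate-∷ʳ (suc s) false (ones j)) ⟩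
    reverse (true ∷ e′) ++ false ∷ Z ++ ones j      ∎)
    where open ≡-Reasoning
  inner [] (suc i) j e pal i<j h F L = isolated e
  inner (true ∷ e′) (suc i) j e pal i<j h F L = isolated e
  inner (false ∷ e′) (suc i) (suc zero) refl pal (s≤s ()) h F L
  inner (false ∷ e′) (suc (suc i)) (suc (suc zero)) refl pal (s≤s (s≤s ())) h F L
  inner (false ∷ e′) (suc zero) (suc (suc zero)) refl pal i<j h F L = ¬palindrome-1011 s e′
    (subst (λ x → Asym (Z ++ true ∷ x)) eq h) (subst FirstOneStuck eq F) (subst LastOneStuck eq L) pal
    where
    eq : (false ∷ e′ ++ true ∷ []) ++ false ∷ true ∷ true ∷ [] ≡ false ∷ e′ ++ 1011′
    eq = ++-assoc (false ∷ e′) (true ∷ []) _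
  inner (false ∷ e′) (suc i) (suc (suc (suc j))) refl pal i<j h F L =
    L (false ∷ (e′ ++ ones (suc i)) ++ false ∷ ones (2 + j)) (sym (ones-∷ʳ (true ∷ μ) false (2 + j)))
      (subst (true ∷ μ ++ false ∷ ones (2 + j) ≺_) (sym (reverse-++-ones (true ∷ μ) false (2 + j))) (cons 0≺1))

  go : (∃[ w ] (Z ≡ u ++ w × ones i ≡ w ++ true ∷ μ)) ⊎ (∃[ b ] ∃[ w ] (u ≡ Z ++ b ∷ w × true ∷ μ ≡ b ∷ w ++ ones i)) → μ ≡ [] × j ≡ 2
  go (inj₁ ([] , e₁ , e₂)) = leading i j e₂ i<j L
  go (inj₁ (b ∷ w , e₁ , e₂)) with replicate-++⁻ (suc s) u (b ∷ w) e₁ | replicate-++⁻ i (b ∷ w) (true ∷ μ) e₂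
  ... | _ , suc _ , _ , refl | suc _ , _ , () , _
  go (inj₂ (b , w , refl , refl)) = ⊥-elim (inner w i j refl
    (trans pal (trans (reverse-++ Z (true ∷ w)) (cong (reverse (true ∷ w) ++_) (reverse-replicate (suc s) false)))) i<j h F L)

-- The leading 0 on the right forces `e` to start with 0. If `f` also starts with 0, that bit takes
-- over the role of the leading 0.
≺-shift : ∀ e f → length e ≡ length f → e ++ false ∷ true ∷ [] ≺ false ∷ f ++ true ∷ [] → e ≺ f
≺-shift [] [] len (cons (cons ()))
≺-shift (false ∷ e) (true ∷ f) len (cons p) = 0≺1
≺-shift (false ∷ e) (false ∷ f) len (cons p) = cons (≺-shift e f (suc-injective len) p)

-- For j = 0 the final 0 could be rotated to the front. For j = 1 the old comparison 1μ01 ≺ 10μ^R1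
-- is shifted by one place. For j ≥ 2 the first 1 is isolated, so 10 faces 11.
lastOne-after-lastZero : ∀ s μ j → Asym (zeros s ++ true ∷ μ ++ false ∷ ones j) →
  FirstOneStuck (μ ++ false ∷ ones j) → (μ ≡ [] → ¬ 2 ≤ j) →
  (true ∷ μ ++ true ∷ ones j ≡ (true ∷ μ ++ ones j) ∷ʳ true) × true ∷ μ ++ ones j ≺ reverse (true ∷ μ ++ ones j)
lastOne-after-lastZero s μ zero h F _ =
  ⊥-elim (⊀-rotation h (zeros s ++ true ∷ μ) (false ∷ []) (sym (++-assoc (zeros s) (true ∷ μ) (false ∷ []))) (zeros-longer s _ _))
lastOne-after-lastZero s μ (suc zero) h F _ =
  sym (ones-∷ʳ (true ∷ μ) true 0) ,
  subst (true ∷ μ ++ true ∷ [] ≺_) (sym (trans (reverse-++-ones (true ∷ μ) true 0) (cong (true ∷_) (unfold-reverse true μ))))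
    (cons (≺-++ (true ∷ []) (true ∷ []) (≺-shift μ (reverse μ) (sym (length-reverse μ)) μ≺)))
  where
  μ≺ : μ ++ false ∷ true ∷ [] ≺ false ∷ reverse μ ++ true ∷ []
  μ≺ with cons p ← subst (true ∷ μ ++ false ∷ true ∷ [] ≺_)
    (trans (reverse-++-ones (true ∷ μ) false 1) (cong (λ x → true ∷ false ∷ x) (unfold-reverse true μ)))
    (Asym-tail-≺-reverse s _ h) = p
lastOne-after-lastZero s μ (suc (suc j)) h F ne =
  sym (ones-∷ʳ (true ∷ μ) true (suc j)) ,
  subst (true ∷ μ ++ true ∷ ones (suc j) ≺_) (sym (reverse-++-ones (true ∷ μ) true (suc j))) (lt μ ne (proj₂ (stuck-isolated-one s _ h F)))
  where
  lt : ∀ μ {τ x} → (μ ≡ [] → ¬ 2 ≤ suc (suc j)) → μ ++ false ∷ ones (suc (suc j)) ≡ false ∷ τ →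
    true ∷ μ ++ true ∷ ones (suc j) ≺ ones (suc j) ++ true ∷ x
  lt [] ne e = ⊥-elim (ne refl (s≤s (s≤s z≤n)))
  lt (false ∷ μ) ne e = cons (subst (false ∷ μ ++ true ∷ ones (suc j) ≺_) (sym (replicate-∷ʳ j true _)) 0≺1)

-- Descent

StartsWithZeros : ℕ → BStr → Set
StartsWithZeros k α = ∃[ τ ] α ≡ zeros k ++ τ

-- Quantifying over lower bounds `k` avoids computing the exact length of the initial run.
Grows : BStr → BStr → Set
Grows α β = ∀ k → StartsWithZeros k α → StartsWithZeros (suc k) β

grows : ∀ s τ β → StartsWithZeros (suc s) β → Grows (zeros s ++ true ∷ τ) β
grows s τ β sw zero _ with σ , refl ← sw = zeros s ++ σ , refl
grows zero τ β sw (suc k) (_ , ())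
grows (suc s) τ (b ∷ β) (σ , e) (suc k) (τ′ , e′) with refl , e₁ ← ∷-injective e
  with ρ , refl ← grows s τ β (σ , e₁) k (τ′ , ∷-injectiveʳ e′) = ρ , refl

≤ᵇ-zeros : ∀ k x y → length x ≡ length (zeros k ++ y) → T (x ≤ᵇ (zeros k ++ y)) → StartsWithZeros k x
≤ᵇ-zeros zero x y len t = x , refl
≤ᵇ-zeros (suc k) (false ∷ x) y len t with τ , refl ← ≤ᵇ-zeros k x y (suc-injective len) t = τ , refl

∷-as-∷ʳ : ∀ (a : Bool) τ → ∃[ x ] ∃[ b ] a ∷ τ ≡ x ∷ʳ b
∷-as-∷ʳ a [] = [] , a , refl
∷-as-∷ʳ a (c ∷ τ) with x , b , e ← ∷-as-∷ʳ c τ = a ∷ x , b , cong (a ∷_) e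

-- The necklace is at most the rotation that brings the new final 0 to the front, and an initial 1
-- in place of a 0 would make it larger.
lastOne-zeros : ∀ s τ → StartsWithZeros (suc s) (lastOne (zeros s ++ true ∷ τ))
lastOne-zeros s τ with x , b , e ← ∷-as-∷ʳ true τ rewrite e = subst (StartsWithZeros (suc s) ∘ lastOne) (∷ʳ-assoc (zeros s) x b)
  (≤ᵇ-zeros (suc s) _ x (sym (Rotation-length (lastOne-rotation (zeros s ++ x) b))) (lastOne-≤ (zeros s ++ x) b))

firstOne-length : ∀ α → length (firstOne α) ≡ length α
firstOne-length [] = refl
firstOne-length (false ∷ α) = cong suc (firstOne-length α)
firstOne-length (true ∷ α) = refl

lastOne-length : ∀ s τ → length (lastOne (zeros s ++ true ∷ τ)) ≡ length (zeros s ++ true ∷ τ)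
lastOne-length s τ with x , b , e ← ∷-as-∷ʳ true τ rewrite e = begin
  length (lastOne (zeros s ++ x ∷ʳ b))    ≡⟨ cong (length ∘ lastOne) (∷ʳ-assoc (zeros s) x b) ⟨
  length (lastOne ((zeros s ++ x) ∷ʳ b))  ≡⟨ Rotation-length (lastOne-rotation (zeros s ++ x) b) ⟨
  length (b ∷ zeros s ++ x)               ≡⟨ length-++-comm (b ∷ []) (zeros s ++ x) ⟩
  length ((zeros s ++ x) ∷ʳ b)            ≡⟨ cong length (∷ʳ-assoc (zeros s) x b) ⟩
  length (zeros s ++ x ∷ʳ b)              ∎
  where open ≡-Reasoning

-- A n α unfolds to a large Boolean expression; this equivalent form is cheap to compute with.
Mem : ℕ → BStr → Set
Mem n α = length α ≡ n × Asym α

-- Arbitrary booleans keep the membership tests of `par` from being unfolded.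
if-cases : ∀ {X : Set} b c (x y z : X) → let w = if b then x else if c then y else z in
  (T b × w ≡ x) ⊎ (T c × w ≡ y) ⊎ (¬ T b × ¬ T c × w ≡ z)
if-cases true c x y z = inj₁ (_ , refl)
if-cases false true x y z = inj₂ (inj₁ (_ , refl))
if-cases false false x y z = inj₂ (inj₂ ((λ ()) , (λ ()) , refl))

par-cases : ∀ n α → (Mem (suc n) (firstOne α) × par (suc n) α ≡ firstOne α)
  ⊎ (Mem (suc n) (lastOne α) × par (suc n) α ≡ lastOne α)
  ⊎ (¬ Mem (suc n) (firstOne α) × ¬ Mem (suc n) (lastOne α) × par (suc n) α ≡ lastZero α)
par-cases n α with if-cases (inA (suc n) (firstOne α)) (inA (suc n) (lastOne α)) (firstOne α) (lastOne α) (lastZero α)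
... | inj₁ (a , e) = inj₁ (A⇒Asym {α = firstOne α} a , e)
... | inj₂ (inj₁ (a , e)) = inj₂ (inj₁ (A⇒Asym {α = lastOne α} a , e))
... | inj₂ (inj₂ (¬f , ¬l , e)) = inj₂ (inj₂ ((λ (l , h) → ¬f (Asym⇒A l h)) , (λ (l , h) → ¬l (Asym⇒A l h)) , e))

lastOne-Mem : ∀ n s τ ρ → Mem n (zeros s ++ true ∷ τ) →
  true ∷ τ ≡ (true ∷ ρ) ∷ʳ true → true ∷ ρ ≺ reverse (true ∷ ρ) → Mem n (lastOne (zeros s ++ true ∷ τ))
lastOne-Mem n s τ ρ (len , h) refl ρ≺ = trans (lastOne-length s τ) len , lastOne-Asym s ρ h ρ≺

root-length : ∀ m s → length (zeros s ++ 1011′) ≡ 6 + m → zeros s ++ 1011′ ≡ r (6 + m)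
root-length m s len = cong (λ k → zeros k ++ 1011′) (+-cancelˡ-≡ 4 s (2 + m) (begin
  4 + s                     ≡⟨ +-comm 4 s ⟩
  s + 4                     ≡⟨ cong (_+ 4) (length-replicate s) ⟨
  length (zeros s) + 4      ≡⟨ length-++ (zeros s) ⟨
  length (zeros s ++ 1011′) ≡⟨ len ⟩
  6 + m                     ∎))
  where open ≡-Reasoning

-- Nonmembership yields both stuck conditions. The palindromic exception would make `α` the root, so
-- `lastZero-Asym` applies.
lastZero-step : ∀ m s τ → let α = zeros (suc s) ++ true ∷ τ in Mem (6 + m) α → α ≢ r (6 + m) →
  ¬ Mem (6 + m) (firstOne α) → ¬ Mem (6 + m) (lastOne α) →
  ∃[ σ ] (lastZero α ≡ zeros (suc s) ++ true ∷ σ × Mem (6 + m) (zeros (suc s) ++ true ∷ σ) ×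
    Mem (6 + m) (lastOne (zeros (suc s) ++ true ∷ σ)))
lastZero-step m s τ (len , h) α≢r ¬f ¬l = result
  where
  n = 6 + m
  Z = zeros (suc s)
  α = Z ++ true ∷ τ
  F : FirstOneStuck τ
  F t β refl β≺ = ¬f (trans (firstOne-length α) len , firstOne-Asym (suc s) t β h β≺)
  L : LastOneStuck τ
  L ρ e ρ≺ = ¬l (lastOne-Mem n (suc s) τ ρ (len , h) e ρ≺)

  from-last-zero : ∀ μ j → τ ≡ μ ++ false ∷ ones j →
    ∃[ σ ] (lastZero α ≡ Z ++ true ∷ σ × Mem n (Z ++ true ∷ σ) × Mem n (lastOne (Z ++ true ∷ σ)))
  from-last-zero μ j refl = μ ++ true ∷ ones j , lastZero≡ , (γ-length , γ-Asym)
    , lastOne-Mem n (suc s) (μ ++ true ∷ ones j) (μ ++ ones j) (γ-length , γ-Asym) (proj₁ next) (proj₂ next)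
    where
    γ = Z ++ true ∷ μ ++ true ∷ ones j
    lastZero≡ : lastZero α ≡ γ
    lastZero≡ = trans (cong lastZero (sym (++-assoc Z (true ∷ μ) _))) (trans (lastZero-ones (Z ++ true ∷ μ) j) (++-assoc Z (true ∷ μ) _))
    γ-length : length γ ≡ n
    γ-length = trans (trans (length-++ Z) (trans (cong (λ k → length Z + suc k)
      (trans (length-++ μ) (sym (length-++ μ)))) (sym (length-++ Z)))) len
    not-root : μ ≡ [] × j ≡ 2 → ⊥
    not-root (refl , refl) = α≢r (root-length m (suc s) len)
    ¬palindromic : ∀ u i → Z ++ true ∷ μ ≡ u ++ ones i → u ≡ reverse u → ¬ i < j
    ¬palindromic u i e pal i<j = not-root (palindromic-stuck⇒root s μ j h F L u i e pal i<j)
    γ-Asym : Asym γ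
    γ-Asym = subst Asym (++-assoc Z (true ∷ μ) (true ∷ ones j))
      (lastZero-Asym (zeros s ++ true ∷ μ) j (subst Asym (sym (++-assoc Z (true ∷ μ) (false ∷ ones j))) h) ¬palindromic)
    -- For empty `μ`, the choice u = `Z`, i = 1 is a palindromic factorization, so 1 < j is
    -- excluded.
    next : true ∷ μ ++ true ∷ ones j ≡ (true ∷ μ ++ ones j) ∷ʳ true × true ∷ μ ++ ones j ≺ reverse (true ∷ μ ++ ones j)
    next = lastOne-after-lastZero (suc s) μ j h F (λ { refl → ¬palindromic Z 1 refl (sym (reverse-replicate (suc s) false)) })

  result : ∃[ σ ] (lastZero α ≡ Z ++ true ∷ σ × Mem n (Z ++ true ∷ σ) × Mem n (lastOne (Z ++ true ∷ σ)))
  result with ones-or-last-zero τ | stuck-isolated-one (suc s) τ h F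
  ... | inj₂ (μ , j , e) | _ = from-last-zero μ j e
  ... | inj₁ (suc k , refl) | _ , ()

par-step : ∀ m α → Mem (6 + m) α → α ≢ r (6 + m) → ∃[ β ] (par (6 + m) α ≡ β × Mem (6 + m) β ×
  (Grows α β ⊎ (∃[ γ ] (par (6 + m) β ≡ γ × Mem (6 + m) γ × Grows α γ))))
par-step m α (len , h) α≢r with s , τ , refl ← Asym-form h with par-cases (5 + m) α
... | inj₁ (a , e) = firstOne α , e , a , inj₁ (grows (suc s) τ _ (τ , firstOne-zeros (suc s) τ))
... | inj₂ (inj₁ (a , e)) = lastOne α , e , a , inj₁ (grows (suc s) τ _ (lastOne-zeros (suc s) τ))
... | inj₂ (inj₂ (¬f , ¬l , e)) with σ , e′ , b , l ← lastZero-step m s τ (len , h) α≢r ¬f ¬l =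
  β , trans e e′ , b , inj₂ next
  where
  β = zeros (suc s) ++ true ∷ σ
  next : ∃[ γ ] (par (6 + m) β ≡ γ × Mem (6 + m) γ × Grows α γ)
  next with par-cases (5 + m) β
  ... | inj₁ (a , e) = firstOne β , e , a , grows (suc s) τ _ (σ , firstOne-zeros (suc s) σ)
  ... | inj₂ (inj₁ (a , e)) = lastOne β , e , a , grows (suc s) τ _ (lastOne-zeros (suc s) σ)
  -- LastZero cannot occur twice in a row, since LastOne has become applicable.
  ... | inj₂ (inj₂ (_ , ¬l , _)) = ⊥-elim (¬l l)

-- A tail 1bcd below its reversal dcb1 needs d = 1, b = 0 and c = 1. A leading 0 joins the initial
-- run, and the at most three bits left admit no solution.
length-four : ∀ s τ → length τ ≡ 4 → Asym (zeros s ++ τ) → τ ≡ 1011′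
length-four s (true ∷ b ∷ c ∷ d ∷ []) _ h with Asym-tail-≺-reverse s _ h
... | cons 0≺1 = refl
... | cons (cons p) = ⊥-elim (≺-irrefl p)
length-four s (false ∷ b ∷ c ∷ d ∷ []) _ h = ⊥-elim (three b c d (drop-zero s _ h))
  where
  drop-zero : ∀ s τ → Asym (zeros s ++ false ∷ τ) → Asym (zeros (suc s) ++ τ)
  drop-zero s τ = subst Asym (replicate-∷ʳ s false τ)
  three : ∀ b c d → ¬ Asym (zeros (suc s) ++ b ∷ c ∷ d ∷ [])
  three true c d h with Asym-tail-≺-reverse (suc s) _ h
  ... | cons p = ≺-irrefl p
  three false c d h with h′ ← drop-zero (suc s) _ h with Asym-tail-≺-reverse (suc (suc s)) _ h′
  ... | cons p = ≺-irrefl p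
  ... | 0≺1 = ≺-irrefl (Asym-tail-≺-reverse (3 + s) _ (drop-zero (2 + s) _ h′))

maximal-run⇒root : ∀ m α → Mem (6 + m) α → StartsWithZeros (2 + m) α → α ≡ r (6 + m)
maximal-run⇒root m α (len , h) (τ , refl) =
  cong (zeros (2 + m) ++_) (length-four (2 + m) τ (+-cancelˡ-≡ (2 + m) (length τ) 4 (begin
    2 + m + length τ                   ≡⟨ cong (_+ length τ) (length-replicate (2 + m)) ⟨
    length (zeros (2 + m)) + length τ  ≡⟨ length-++ (zeros (2 + m)) ⟨
    length (zeros (2 + m) ++ τ)        ≡⟨ len ⟩
    6 + m                              ≡⟨ +-comm 4 (2 + m) ⟩
    2 + m + 4                          ∎)) h)
  where open ≡-Reasoning

parStep-cases : ∀ n α → α ≡ r n ⊎ (α ≢ r n × parStep n α ≡ par n α)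
parStep-cases n α = go (α ==ᵇ r n) refl
  where
  go : ∀ b → α ==ᵇ r n ≡ b → α ≡ r n ⊎ (α ≢ r n × (if b then α else par n α) ≡ par n α)
  go true e = inj₁ (==ᵇ⇒≡ α (r n) (Equivalence.from T-≡ e))
  go false e = inj₂ ((λ α≡r → subst T (trans (sym (cong (_==ᵇ r n) α≡r)) e) (==ᵇ-refl (r n))) , refl)

-- `f` counts the zeros missing from the maximal run of n - 4 = 2 + m; each costs at most two steps
-- by `par-step`.
reach-root : ∀ m f k α → Mem (6 + m) α → StartsWithZeros k α → k + f ≡ 2 + m →
  ∃[ d ] (d ≤ 2 * f × iter (parStep (6 + m)) d α ≡ r (6 + m))
reach-root m zero k α a sw e =
  0 , z≤n , maximal-run⇒root m α a (subst (λ k → StartsWithZeros k α) (trans (sym (+-identityʳ k)) e) sw)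
reach-root m (suc f) k α a sw e = from-α (parStep-cases n α)
  where
  n = 6 + m
  Reaches : ℕ → BStr → Set
  Reaches b β = ∃[ d ] (d ≤ b × iter (parStep n) d β ≡ r n)
  step : ∀ {b β γ} → parStep n β ≡ γ → Reaches b γ → Reaches (suc b) β
  step p (d , d≤b , q) = suc d , s≤s d≤b , trans (cong (iter (parStep n) d) p) q
  weaken : ∀ {b β} → Reaches b β → Reaches (suc b) β
  weaken (d , d≤b , q) = d , m≤n⇒m≤1+n d≤b , q
  continue : ∀ β → Mem n β → Grows α β → Reaches (2 * f) β
  continue β b g = reach-root m f (suc k) β b (g k sw) (trans (sym (+-suc k f)) e)
  from-β : ∀ β → (∃[ γ ] (par n β ≡ γ × Mem n γ × Grows α γ)) → β ≡ r n ⊎ (β ≢ r n × parStep n β ≡ par n β) → Reaches (1 + 2 * f) β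
  -- The intermediate string may already be the root, where `parStep` stops.
  from-β β _ (inj₁ β≡r) = 0 , z≤n , β≡r
  from-β β (γ , p , c , g) (inj₂ (_ , q)) = step (trans q p) (continue γ c g)
  from-α : α ≡ r n ⊎ (α ≢ r n × parStep n α ≡ par n α) → Reaches (2 * suc f) α
  from-α (inj₁ α≡r) = 0 , z≤n , α≡r
  from-α (inj₂ (α≢r , q)) = subst (λ b → Reaches b α) (sym (*-suc 2 f)) (first (par-step m α a α≢r))
    where
    first : ∃[ β ] (par n α ≡ β × Mem n β × (Grows α β ⊎ (∃[ γ ] (par n β ≡ γ × Mem n γ × Grows α γ)))) → Reaches (2 + 2 * f) α
    first (β , p , b , inj₁ g) = step (trans q p) (weaken (continue β b g))
    first (β , p , b , inj₂ next) = step (trans q p) (from-β β next (parStep-cases n β))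

r∈A : ∀ m → A (6 + m) (r (6 + m))
r∈A m = Asym⇒A (trans (length-++ (zeros (2 + m))) (trans (cong (_+ 4) (length-replicate (2 + m))) (+-comm (2 + m) 4)))
  (longest-run-Asym (2 + m) (false ∷ true ∷ true ∷ []) (cons 0≺1) (λ a b → no-double-zero a))
  where
  no-double-zero : ∀ a {b} → 1011′ ≢ a ++ false ∷ false ∷ b
  no-double-zero [] ()
  no-double-zero (_ ∷ []) ()
  no-double-zero (_ ∷ _ ∷ []) ()
  no-double-zero (_ ∷ _ ∷ _ ∷ []) ()
  no-double-zero (_ ∷ _ ∷ _ ∷ _ ∷ []) ()
  no-double-zero (_ ∷ _ ∷ _ ∷ _ ∷ _ ∷ _) ()

theorem2 : ∀ (n : ℕ) → 6 ≤ n →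
    A n (r n)
    × (∀ (α : BStr) → A n α → α ≢ r n → A n (par n α))
    × (∀ (α : BStr) → A n α → ∃[ k ] (k < 2 * (n ∸ 4) × iter (parStep n) k α ≡ r n))
theorem2 (suc (suc (suc (suc (suc (suc m)))))) (s≤s (s≤s (s≤s (s≤s (s≤s (s≤s z≤n)))))) =
  r∈A m , parent , reach
  where
  parent : ∀ α → A (6 + m) α → α ≢ r (6 + m) → A (6 + m) (par (6 + m) α)
  parent α a α≢r with β , e , (len , h) , _ ← par-step m α (A⇒Asym {5 + m} {α} a) α≢r =
    subst (A (6 + m)) (sym e) (Asym⇒A len h)
  reach : ∀ α → A (6 + m) α → ∃[ k ] (k < 2 * (2 + m) × iter (parStep (6 + m)) k α ≡ r (6 + m))
  -- Every member starts with 0, so k = 1 and 1 + m zeros are missing; 2 (1 + m) steps stay strictly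
  -- below 2 (2 + m).
  reach α a with len , h ← A⇒Asym {5 + m} {α} a with s , τ , e ← Asym-form h
    with d , d≤ , q ← reach-root m (1 + m) 1 α (len , h) (zeros s ++ true ∷ τ , e) refl =
    d , subst (d <_) (sym (*-suc 2 (1 + m))) (s≤s (m≤n⇒m≤1+n d≤)) , q
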